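{- There exist sets $A,B\subseteq\Sigma^*$ such that $B\leq^p_{2\text{ - }tt}A$, $B\not\leq^p_{li\text{ - }T}A$, and $B\not\leq^p_{ld\text{ - }T}A$.
   Context: $\Sigma=\{0,1\}$; $|x|$ is the length of $x$; $\chi_A$ is the characteristic function of $A$; $\langle\cdot,\dots,\cdot\rangle$ is a one-to-one, polynomial-time computable and invertible multiarity pairing function. A DPTM is a deterministic oracle Turing machine $M$ for which there is one polynomial $p$ such that, for every oracle $X\subseteq\Sigma^*$ and input $x$, $M^X(x)$ halts within $p(|x|)$ steps; $L(M^X)$ is the set of inputs accepted with oracle $X$. $B\leq^p_{2\text{ - }tt}A$: there are a deterministic polynomial-time machine $M$ (without oracle) and a polynomial-time computable $f$ such that for each $x$ there is $m\le 2$ with $f(x)=\langle q_1,\dots,q_m\rangle$, and $M(\langle x,\chi_A(q_1),\dots,\chi_A(q_m)\rangle)$ accepts if and only if $x\in B$. $B\leq^p_{li\text{ - }T}A$ (respectively $B\leq^p_{ld\text{ - }T}A$): there is a DPTM $M$ with $L(M^A)=B$ such that for every input $x$ the sequence $q_1,\dots,q_k$ ($k\ge0$), in order, of queries made by $M^A(x)$ to its oracle satisfies $|q_1|<|q_2|<\dots<|q_k|$ (respectively $|q_1|>|q_2|>\dots>|q_k|$). -}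

module Defs where

open import Data.Bool.Base using (Bool; true; false)
open import Data.Fin.Base using (Fin)
open import Data.List.Base
  using (List; []; _∷_; _++_; [_]; length; map; fromMaybe)
open import Data.List.Properties using (∷-injective)
open import Data.List.Relation.Unary.Linked using (Linked)
open import Data.Maybe.Base as Maybe using (Maybe; just; nothing)
open import Data.Nat.Base using (ℕ; zero; suc; _+_; _*_; _≤_; _<_; _>_)
open import Data.Product.Base using (Σ; ∃-syntax; _×_; _,_; proj₁)
open import Data.Vec.Base as Vec using (Vec; _∷_)
open import Function.Base using (_on_)
open import Relation.Binary.PropositionalEquality
  using (_≡_; _≗_; refl; cong₂)
open import Relation.Nullary.Negation using (¬_)

Word : Set
Word = List Bool

-- A set of words is given by its characteristic function.
Language : Set
Language = Word → Bool

∅ : Language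
∅ _ = false

-- The tuple ⟨x₁,…,xₘ⟩: every bit b of every component is written as 1b, and
-- every component is closed by a 0.  A single left-to-right pass computes or
-- inverts this map.
encodeThen : Word → Word → Word
encodeThen []      rest = false ∷ rest
encodeThen (b ∷ x) rest = true ∷ b ∷ encodeThen x rest

⟨_⟩ : List Word → Word
⟨ []     ⟩ = []
⟨ x ∷ xs ⟩ = encodeThen x ⟨ xs ⟩

encodeThen-injective : ∀ x y {u v} → encodeThen x u ≡ encodeThen y v →
                       x ≡ y × u ≡ v
encodeThen-injective []      []      refl = refl , refl
encodeThen-injective (b ∷ x) (c ∷ y) eq
  with refl , eq₁ ← ∷-injective eq
  with refl , eq₂ ← ∷-injective eq₁
  with refl , u≡v ← encodeThen-injective x y eq₂ = refl , u≡v

encodeThen≢[] : ∀ x {u} → ¬ (encodeThen x u ≡ [])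
encodeThen≢[] []      ()
encodeThen≢[] (_ ∷ _) ()

⟨⟩-injective : ∀ xs ys → ⟨ xs ⟩ ≡ ⟨ ys ⟩ → xs ≡ ys
⟨⟩-injective []             []             eq = refl
⟨⟩-injective []             ([] ∷ ys)      ()
⟨⟩-injective []             ((_ ∷ _) ∷ ys) ()
⟨⟩-injective (x ∷ xs)       []             eq with () ← encodeThen≢[] x eq
⟨⟩-injective (x ∷ xs)       (y ∷ ys)       eq
  with x≡y , eq′ ← encodeThen-injective x y eq =
  cong₂ _∷_ x≡y (⟨⟩-injective xs ys eq′)

-- Coefficients, constant term first.
Polynomial : Set
Polynomial = List ℕ

eval : Polynomial → ℕ → ℕ
eval []      n = 0
eval (a ∷ p) n = a + n * eval p n

data Symbol (aux : ℕ) : Set where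
  blank : Symbol aux
  bit   : Bool → Symbol aux
  other : Fin aux → Symbol aux

data Direction : Set where
  left stay right : Direction

-- A two-way infinite tape: the cells left of the head (nearest first), the
-- scanned cell, and the cells right of the head (nearest first); all cells
-- beyond the two lists are blank.
record Tape (aux : ℕ) : Set where
  constructor tape
  field
    before  : List (Symbol aux)
    scanned : Symbol aux
    after   : List (Symbol aux)

open Tape public

blankTape : ∀ {aux} → Tape aux
blankTape = tape [] blank []

inputTape : ∀ {aux} → Word → Tape aux
inputTape []      = blankTape
inputTape (b ∷ x) = tape [] (bit b) (map bit x)

move : ∀ {aux} → Direction → Tape aux → Tape aux
move stay  t                   = t
move left  (tape []       s r) = tape [] blank (s ∷ r)
move left  (tape (a ∷ l)  s r) = tape l a (s ∷ r)
move right (tape l s [])       = tape (s ∷ l) blank []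
move right (tape l s (a ∷ r))  = tape (s ∷ l) a r

writeMove : ∀ {aux} → Symbol aux × Direction → Tape aux → Tape aux
writeMove (s , d) (tape l _ r) = move d (tape l s r)

-- Besides its read-write tapes, a machine has two append-only tapes over
-- {0,1}, the query tape and the output tape; a `work` step appends at most one
-- bit to each.  A `query` step asks the oracle about the word on the query
-- tape, erases that tape, and branches on the answer.  A `halt` step stops,
-- accepting iff its argument is `true`.
data Action (aux tapes states : ℕ) : Set where
  halt  : (accept : Bool) → Action aux tapes states
  query : (ifYes ifNo : Fin states) → Action aux tapes states
  work  : (next : Fin states)
          (writes : Vec (Symbol aux × Direction) tapes)
          (toQuery toOutput : Maybe Bool) →
          Action aux tapes states

-- Deterministic oracle Turing machines; there are `suc extra` read-write tapes,
-- the first of which initially holds the input.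
record OracleTM : Set where
  field
    aux extra states : ℕ
    start   : Fin states
    program : Fin states → Vec (Symbol aux) (suc extra) →
              Action aux (suc extra) states

record Outcome : Set where
  constructor outcome
  field
    accepted : Bool
    output   : Word
    queries  : List Word   -- in the order in which they were asked

open Outcome public

addQuery : Word → Outcome → Outcome
addQuery q (outcome a o qs) = outcome a o (q ∷ qs)

module _ (M : OracleTM) where
  open OracleTM M

  record Config : Set where
    constructor config
    field
      state      : Fin states
      tapes      : Vec (Tape aux) (suc extra)
      queryTape  : Word
      outputTape : Word

  initial : Word → Config
  initial x = config start (inputTape x ∷ Vec.replicate extra blankTape) [] []

  branch : Bool → Fin states → Fin states → Fin states
  branch true  yes no = yes
  branch false yes no = no

  -- `run X t c` is the outcome of the computation from c with oracle X if it
  -- halts within t steps (the halting step included), and `nothing` otherwise.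
  mutual
    run : Language → ℕ → Config → Maybe Outcome
    run X zero    c = nothing
    run X (suc t) c =
      perform X t c (program (Config.state c) (Vec.map scanned (Config.tapes c)))

    perform : Language → ℕ → Config → Action aux (suc extra) states →
              Maybe Outcome
    perform X t (config s ts q o) (halt a)         = just (outcome a o [])
    perform X t (config s ts q o) (query yes no)   =
      Maybe.map (addQuery q) (run X t (config (branch (X q) yes no) ts [] o))
    perform X t (config s ts q o) (work s′ ws b c) =
      run X t (config s′ (Vec.zipWith writeMove ws ts)
                      (q ++ fromMaybe b) (o ++ fromMaybe c))

  OracleFree : Set
  OracleFree = ∀ s v yes no → ¬ (program s v ≡ query yes no)

record DPTM : Set where
  field
    machine : OracleTM
    bound   : Polynomial
    halts   : ∀ (X : Language) (x : Word) →
              ∃[ r ] run machine X (eval bound (length x)) (initial machine x)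
                     ≡ just r

  result : Language → Word → Outcome
  result X x = proj₁ (halts X x)

  -- L(M^X)
  L : Language → Language
  L X x = accepted (result X x)

open DPTM public using (machine; result; L)

-- A polynomial-time machine without oracle is a DPTM whose program contains no
-- query; the oracle it is run with is then irrelevant, and is taken to be ∅.
record PlainPTM : Set where
  field
    dptm       : DPTM
    oracleFree : OracleFree (machine dptm)

  accepts : Word → Bool
  accepts = L dptm ∅

  computes : Word → Word
  computes x = output (result dptm ∅ x)

open PlainPTM public using (accepts; computes)

PolyTimeComputable : (Word → Word) → Set
PolyTimeComputable f = ∃[ F ] computes F ≗ f

infix 4 _≤ᵖ2-tt_ _≤ᵖli-T_ _≤ᵖld-T_

_≤ᵖ2-tt_ : Language → Language → Set
B ≤ᵖ2-tt A =
  Σ PlainPTM λ M → Σ (Word → Word) λ f → PolyTimeComputable f ×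
    (∀ x → ∃[ qs ] length qs ≤ 2 × f x ≡ ⟨ qs ⟩ ×
           accepts M ⟨ x ∷ map (λ q → [ A q ]) qs ⟩ ≡ B x)

_≤ᵖli-T_ : Language → Language → Set
B ≤ᵖli-T A =
  Σ DPTM λ M → L M A ≗ B ×
    (∀ x → Linked (_<_ on length) (queries (result M A x)))

_≤ᵖld-T_ : Language → Language → Set
B ≤ᵖld-T A =
  Σ DPTM λ M → L M A ≗ B ×
    (∀ x → Linked (_>_ on length) (queries (result M A x)))

{-# OPTIONS --safe #-}

-- Let B(x) = A(q₁) ∨ A(q₂), where q₁ and q₂ are the first two components of x.
-- A machine whose queries have strictly monotone lengths asks at most one word
-- of each length, so on x = ⟨q₁,q₂⟩ with q₁ ≠ q₂ of equal length it misses one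
-- of the two.  Diagonalise over all clocked machines, with A so far containing
-- nothing of the length of q₁: if the current machine rejects x, put one of the
-- qᵢ that it did not ask into A; in any case freeze A beyond the lengths of all
-- its queries.  If it asked both, A stays as it is, so the machine asks both
-- with the final A as well and its queries are not monotone in length.
module Submission where

open import Data.Bool.Base using (Bool; true; false; _∨_)
open import Data.Bool.Properties using (∨-zeroʳ) renaming (_≟_ to _≟ᵇ_)
open import Data.Fin.Base using (Fin; zero; suc)
open import Data.Fin.Patterns
open import Data.List.Base as List using (List; []; _∷_; _++_; [_]; length; map; replicate)
open import Data.List.Membership.DecPropositional using () renaming (_∈?_ to member?)
open import Data.List.Membership.Propositional using (_∈_; _∉_)
open import Data.List.Membership.Propositional.Properties using (∈-allFin)
open import Data.List.Properties using (++-assoc; ++-identityʳ; ≡-dec; length-replicate)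
open import Data.List.Relation.Unary.All as All using (All; []; _∷_)
open import Data.List.Relation.Unary.AllPairs as AllPairs using (AllPairs; []; _∷_)
open import Data.List.Relation.Unary.Any using (here; there)
open import Data.List.Relation.Unary.Linked.Properties using (Linked⇒AllPairs)
open import Data.Maybe.Base as Maybe using (Maybe; just; nothing)
open import Data.Maybe.Properties using (just-injective)
open import Data.Nat.Base using (ℕ; zero; suc; _+_; _∸_; _≤_; _<_; z≤n; s≤s)
open import Data.Nat.Binary.Base using (ℕᵇ; 2[1+_]; 1+[2_]; fromℕ; toℕ) renaming (zero to 0ᵇ)
open import Data.Nat.Binary.Properties using (fromℕ-toℕ)
open import Data.Nat.ListAction using (sum)
open import Data.Nat.Properties
  using (*-zeroʳ; *-identityʳ; +-comm; +-suc; ≤-refl; ≤-reflexive; ≤-trans; ≤-total; ≤-<-trans;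
         <-trans; <⇒≢; >⇒≢; m≤m+n; m≤n+m; m≤n⇒m≤1+n; m∸n+n≡m)
open import Data.Product.Base using (∃; ∃₂; ∃-syntax; _×_; _,_; proj₁; proj₂; uncurry)
open import Data.Sum.Base using (_⊎_; inj₁; inj₂)
open import Data.Vec.Base as Vec using (Vec; []; _∷_)
open import Data.Vec.Properties using (toList∘fromList)
open import Function.Base using (_on_; _∘_)
open import Relation.Binary.PropositionalEquality
  using (_≡_; _≢_; _≗_; refl; sym; trans; cong; cong₂; subst)
open import Relation.Nullary.Decidable using (Dec; yes; no; does; dec-true; dec-false)
open import Relation.Nullary.Negation using (¬_; contradiction)
open import Defs

-- Reading the first two components of a tuple

first : Word → Word
first []              = []
first (false ∷ w)     = []
first (true ∷ [])     = [ false ]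
first (true ∷ b ∷ w)  = b ∷ first w

rest : Word → Word
rest []              = []
rest (false ∷ w)     = w
rest (true ∷ [])     = []
rest (true ∷ b ∷ w)  = rest w

first-encodeThen : ∀ x u → first (encodeThen x u) ≡ x
first-encodeThen []      u = refl
first-encodeThen (b ∷ x) u = cong (b ∷_) (first-encodeThen x u)

rest-encodeThen : ∀ x u → rest (encodeThen x u) ≡ u
rest-encodeThen []      u = refl
rest-encodeThen (b ∷ x) u = rest-encodeThen x u

-- Total on words that are not tuples, missing bits being read as the closing 0,
-- or as false after a 1.
components : Word → List Word
components x = first x ∷ first (rest x) ∷ []

-- One-way scanners and the two machines of the truth-table reduction

tapeAt : ∀ {aux} → List (Symbol aux) → Word → Tape aux
tapeAt l []      = tape l blank []
tapeAt l (b ∷ w) = tape l (bit b) (map bit w)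

inputTape≡tapeAt : ∀ {aux} x → inputTape {aux} x ≡ tapeAt [] x
inputTape≡tapeAt []      = refl
inputTape≡tapeAt (b ∷ x) = refl

move-right : ∀ {aux} l (s : Symbol aux) w →
             move right (tape l s (map bit w)) ≡ tapeAt (s ∷ l) w
move-right l s []      = refl
move-right l s (b ∷ w) = refl

read : Symbol 0 → Maybe Bool
read blank   = nothing
read (bit b) = just b

-- A one-way automaton with output: in a given state and on a given input bit
-- (`nothing` past the end) it halts, or moves on and outputs at most one bit.
Transitions : ℕ → Set
Transitions n = Fin n → Maybe Bool → Bool ⊎ (Fin n × Maybe Bool)

-- The head never returns to a cell it has left, so the blank written there loses nothing.
act : ∀ {n} → Bool ⊎ (Fin n × Maybe Bool) → Action 0 1 n
act (inj₁ a)       = halt a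
act (inj₂ (s , b)) = work s ((blank , right) ∷ []) nothing b

scanner : ∀ {n} → Transitions (suc n) → OracleTM
scanner {n} δ = record
  { aux = 0 ; extra = 0 ; states = suc n ; start = 0F
  ; program = λ { s (a ∷ []) → act (δ s (read a)) } }

scanner-oracleFree : ∀ {n} (δ : Transitions (suc n)) → OracleFree (scanner δ)
scanner-oracleFree δ s (a ∷ []) _ _ eq with δ s (read a)
... | inj₁ _ with () ← eq
... | inj₂ _ with () ← eq

-- With the length as first summand, the time budget unfolds letter by letter, in step with the
-- inductions on the input.
eval-linear : ∀ c n → eval (c ∷ 1 ∷ []) n ≡ n + c
eval-linear c n rewrite *-zeroʳ n | *-identityʳ n = +-comm c n

-- States 0 and 1 copy the first component, 2 and 3 the second.
splitting : Transitions 5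
splitting 0F (just true) = inj₂ (1F , just true)
splitting 0F _           = inj₂ (2F , just false)
splitting 1F b           = inj₂ (0F , just (Maybe.fromMaybe false b))
splitting 2F (just true) = inj₂ (3F , just true)
splitting 2F _           = inj₂ (4F , just false)
splitting 3F b           = inj₂ (2F , just (Maybe.fromMaybe false b))
splitting 4F _           = inj₁ true

splitter : OracleTM
splitter = scanner splitting

++-snoc₂ : ∀ {A : Set} (o : List A) a b w → ((o ++ [ a ]) ++ [ b ]) ++ w ≡ o ++ a ∷ b ∷ w
++-snoc₂ o a b w = trans (++-assoc (o ++ [ a ]) [ b ] w) (++-assoc o [ a ] (b ∷ w))

-- Besides one step per unread letter, three steps suffice: one for the bit missing after a dangling
-- 1, one for the closing 0 and one for halting.
splitter-second : ∀ X w l o t →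
  run splitter X (length w + (3 + t)) (config 2F (tapeAt l w ∷ []) [] o)
  ≡ just (outcome true (o ++ ⟨ first w ∷ [] ⟩) [])
splitter-second X []          l o t = refl
splitter-second X (false ∷ w) l o t
  rewrite move-right l blank w | +-suc (length w) (2 + t) = refl
splitter-second X (true ∷ []) l o t =
  cong (λ o → just (outcome true o [])) (++-snoc₂ o true false [ false ])
splitter-second X (true ∷ b ∷ w) l o t
  rewrite move-right (blank ∷ l) blank w =
  trans (splitter-second X w (blank ∷ blank ∷ l) _ t)
        (cong (λ o → just (outcome true o [])) (++-snoc₂ o true b _))

splitter-run : ∀ X w l o t →
  run splitter X (length w + (4 + t)) (config 0F (tapeAt l w ∷ []) [] o)
  ≡ just (outcome true (o ++ ⟨ components w ⟩) [])
splitter-run X []             l o t =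
  cong (λ o → just (outcome true o [])) (++-assoc o _ _)
splitter-run X (false ∷ w)    l o t
  rewrite move-right l blank w =
  trans (splitter-second X w (blank ∷ l) _ (suc t))
        (cong (λ o → just (outcome true o [])) (++-assoc o _ _))
splitter-run X (true ∷ [])    l o t =
  cong (λ o → just (outcome true o []))
       (trans (++-assoc ((o ++ [ true ]) ++ [ false ]) _ _) (++-snoc₂ o true false _))
splitter-run X (true ∷ b ∷ w) l o t
  rewrite move-right (blank ∷ l) blank w =
  trans (splitter-run X w (blank ∷ blank ∷ l) _ t)
        (cong (λ o → just (outcome true o [])) (++-snoc₂ o true b _))

scannerPTM : ∀ {n} (δ : Transitions (suc n)) c (h : Word → Outcome) →
  (∀ X x → run (scanner δ) X (length x + c) (config 0F (tapeAt [] x ∷ []) [] [])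
           ≡ just (h x)) →
  ∃[ M ] ∀ x → result (PlainPTM.dptm M) ∅ x ≡ h x
scannerPTM δ c h runs =
  record { dptm = record { machine = scanner δ ; bound = c ∷ 1 ∷ []
                         ; halts = λ X x → h x , halts X x }
         ; oracleFree = scanner-oracleFree δ } ,
  -- The halting proof carries `h x` as its witness, so `result` reduces to it.
  λ x → refl
  where
  halts : ∀ X x → run (scanner δ) X (eval (c ∷ 1 ∷ []) (length x)) (initial (scanner δ) x)
                  ≡ just (h x)
  halts X x rewrite eval-linear c (length x) | inputTape≡tapeAt {0} x = runs X x

components-computable : PolyTimeComputable (⟨_⟩ ∘ components)
components-computable
  with F , F-result ← scannerPTM splitting 4 (λ x → outcome true ⟨ components x ⟩ [])
                        (λ X x → splitter-run X x [] [] 0) =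
  F , λ x → cong output (F-result x)

-- A one-bit word is coded by three letters, 1, its bit and 0, hence the steps of three. On words of
-- another form the value only has to agree with what `disjoiner` does.
someTrue : Word → Bool
someTrue (true ∷ true  ∷ w)     = true
someTrue (true ∷ false ∷ _ ∷ w) = someTrue w
someTrue _                      = false

-- States 0 and 1 skip the first component; 2, 3 and 4 read the tuple of
-- one-bit words after it.
disjoining : Transitions 5
disjoining 0F (just true)  = inj₂ (1F , nothing)
disjoining 0F (just false) = inj₂ (2F , nothing)
disjoining 0F nothing      = inj₁ false
disjoining 1F _            = inj₂ (0F , nothing)
disjoining 2F (just true)  = inj₂ (3F , nothing)
disjoining 2F _            = inj₁ false
disjoining 3F (just true)  = inj₁ true
disjoining 3F _            = inj₂ (4F , nothing)
disjoining 4F _            = inj₂ (2F , nothing)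

disjoiner : OracleTM
disjoiner = scanner disjoining

disjoiner-second : ∀ X w l t →
  run disjoiner X (length w + (3 + t)) (config 2F (tapeAt l w ∷ []) [] [])
  ≡ just (outcome (someTrue w) [] [])
disjoiner-second X []                     l t = refl
disjoiner-second X (false ∷ w)            l t = refl
disjoiner-second X (true ∷ [])            l t = refl
disjoiner-second X (true ∷ true ∷ w)      l t = refl
disjoiner-second X (true ∷ false ∷ [])    l t = refl
disjoiner-second X (true ∷ false ∷ b ∷ w) l t
  rewrite move-right (blank ∷ blank ∷ l) blank w = disjoiner-second X w _ t

disjoiner-run : ∀ X w l t →
  run disjoiner X (length w + (3 + t)) (config 0F (tapeAt l w ∷ []) [] [])
  ≡ just (outcome (someTrue (rest w)) [] [])
disjoiner-run X []             l t = refl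
disjoiner-run X (false ∷ w)    l t
  rewrite move-right l blank w = disjoiner-second X w _ t
disjoiner-run X (true ∷ [])    l t = refl
disjoiner-run X (true ∷ b ∷ w) l t
  rewrite move-right (blank ∷ l) blank w = disjoiner-run X w _ t

orLanguage : Language → Language
orLanguage A x = A (first x) ∨ A (first (rest x))

someTrue-singletons : ∀ a b → someTrue ⟨ [ a ] ∷ [ b ] ∷ [] ⟩ ≡ a ∨ b
someTrue-singletons true  _     = refl
someTrue-singletons false true  = refl
someTrue-singletons false false = refl

orLanguage-≤ᵖ2-tt : ∀ A → orLanguage A ≤ᵖ2-tt A
orLanguage-≤ᵖ2-tt A
  with M , M-result ← scannerPTM disjoining 3 (λ x → outcome (someTrue (rest x)) [] [])
                        (λ X x → disjoiner-run X x [] 0) =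
  M , ⟨_⟩ ∘ components , components-computable , λ x →
  components x , ≤-refl , refl ,
  trans (cong accepted (M-result _))
        (trans (cong someTrue (rest-encodeThen x _))
               (someTrue-singletons (A (first x)) (A (first (rest x)))))

-- Enumerating the machines

-- Programs are functions, so machines are enumerated up to pointwise equality.
data _≈_ : OracleTM → OracleTM → Set where
  same : ∀ {k e n i δ δ′} → (∀ s v → δ s v ≡ δ′ s v) →
         record { aux = k ; extra = e ; states = n ; start = i ; program = δ } ≈
         record { aux = k ; extra = e ; states = n ; start = i ; program = δ′ }

-- Induction on the time. `Config M` and `Config M′` are different types although their fields
-- agree, so configurations are spelled out by components.
run-initial-≈ : ∀ {M M′} → M ≈ M′ → ∀ X t x →
                run M X t (initial M x) ≡ run M′ X t (initial M′ x)
run-initial-≈ (same {k} {e} {n} {i} {δ} {δ′} δ≗δ′) X t x =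
  run-≈ t i (inputTape x ∷ Vec.replicate e blankTape) [] []
  where
  M M′ : OracleTM
  M  = record { aux = k ; extra = e ; states = n ; start = i ; program = δ }
  M′ = record { aux = k ; extra = e ; states = n ; start = i ; program = δ′ }

  run-≈ : ∀ t s ts q o → run M X t (config s ts q o) ≡ run M′ X t (config s ts q o)
  perform-≈ : ∀ t s ts q o a →
    perform M X t (config s ts q o) a ≡ perform M′ X t (config s ts q o) a
  run-≈ zero    s ts q o = refl
  run-≈ (suc t) s ts q o =
    trans (perform-≈ t s ts q o (δ s (Vec.map scanned ts)))
          (cong (perform M′ X t (config s ts q o)) (δ≗δ′ s (Vec.map scanned ts)))
  perform-≈ t s ts q o (halt _) = refl
  perform-≈ t s ts q o (query s₁ s₂) with X q
  ... | true  = cong (Maybe.map (addQuery q)) (run-≈ t s₁ ts [] o)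
  ... | false = cong (Maybe.map (addQuery q)) (run-≈ t s₂ ts [] o)
  perform-≈ t s ts q o (work s′ ws b c) =
    run-≈ t s′ (Vec.zipWith writeMove ws ts) (q ++ List.fromMaybe b) (o ++ List.fromMaybe c)

-- Decoders and their composition

Decoder : Set → Set
Decoder A = Word → A × Word

-- On some code, whatever follows it, d returns a value satisfying P and leaves
-- the rest unread.
record Yields {A : Set} (d : Decoder A) (P : A → Set) : Set where
  constructor yields
  field
    code      : Word
    value     : A
    satisfies : P value
    decodes   : ∀ u → d (code ++ u) ≡ (value , u)

Complete : ∀ {A} → Decoder A → Set
Complete d = ∀ a → Yields d (_≡ a)

opaque
  return : ∀ {A} → A → Decoder A
  return a w = a , w

  yields-return : ∀ {A} {P : A → Set} {a} → P a → Yields (return a) P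
  yields-return p = yields [] _ p λ u → refl

  infixl 1 _>>=_
  _>>=_ : ∀ {A B} → Decoder A → (A → Decoder B) → Decoder B
  (d >>= f) w = uncurry f (d w)

  -- Codes are concatenated: `d` stops exactly at the end of its own code, whatever follows. The
  -- second code may depend on the value that `d` returned.
  yields->>= : ∀ {A B} {d : Decoder A} {f : A → Decoder B} {P : A → Set} {Q : B → Set} →
               Yields d P → (∀ {a} → P a → Yields (f a) Q) → Yields (d >>= f) Q
  yields->>= {d = d} {f} (yields w a p eq) g with yields v b q eq′ ← g p =
    yields (w ++ v) b q λ u →
    trans (cong (uncurry f ∘ d) (++-assoc w v u))
          (trans (cong (uncurry f) (eq (v ++ u))) (eq′ u))

opaque
  natural : Decoder ℕ
  natural []          = 0 , []
  natural (false ∷ w) = 0 , w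
  natural (true ∷ w)  with n , u ← natural w = suc n , u

  natural-complete : Complete natural
  natural-complete zero    = yields [ false ] _ refl λ u → refl
  natural-complete (suc n) with yields w _ refl eq ← natural-complete n =
    yields (true ∷ w) _ refl λ u → cong (λ (n , u) → suc n , u) (eq u)

  -- The position in the list is coded in unary; the last position needs no closing 0.
  oneOf : ∀ {A} → A → List A → Decoder A
  oneOf a []       w           = a , w
  oneOf a (b ∷ bs) []          = a , []
  oneOf a (b ∷ bs) (false ∷ w) = a , w
  oneOf a (b ∷ bs) (true ∷ w)  = oneOf b bs w

  oneOf-complete : ∀ {A : Set} {a b : A} {bs} → a ∈ b ∷ bs → Yields (oneOf b bs) (_≡ a)
  oneOf-complete {bs = []}    (here refl) = yields [] _ refl λ u → refl
  oneOf-complete {bs = _ ∷ _} (here refl) = yields [ false ] _ refl λ u → refl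
  oneOf-complete {bs = _ ∷ _} (there p)   with yields w a q eq ← oneOf-complete p =
    yields (true ∷ w) a q eq

-- Decoders for actions, machines and clocks

boolean : Decoder Bool
boolean = oneOf false [ true ]

boolean-complete : Complete boolean
boolean-complete false = oneOf-complete (here refl)
boolean-complete true  = oneOf-complete (there (here refl))

direction : Decoder Direction
direction = oneOf left (stay ∷ right ∷ [])

direction-complete : Complete direction
direction-complete left  = oneOf-complete (here refl)
direction-complete stay  = oneOf-complete (there (here refl))
direction-complete right = oneOf-complete (there (there (here refl)))

optionalBit : Decoder (Maybe Bool)
optionalBit = oneOf nothing (just false ∷ just true ∷ [])

optionalBit-complete : Complete optionalBit
optionalBit-complete nothing      = oneOf-complete (here refl)
optionalBit-complete (just false) = oneOf-complete (there (here refl))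
optionalBit-complete (just true)  = oneOf-complete (there (there (here refl)))

finite : ∀ n → Decoder (Fin (suc n))
finite n = oneOf zero (List.tabulate suc)

finite-complete : ∀ n → Complete (finite n)
finite-complete n i = oneOf-complete (∈-allFin i)

fromFin : ∀ {k} → Fin (3 + k) → Symbol k
fromFin 0F                  = blank
fromFin 1F                  = bit false
fromFin 2F                  = bit true
fromFin (suc (suc (suc i))) = other i

toFin : ∀ {k} → Symbol k → Fin (3 + k)
toFin blank       = 0F
toFin (bit false) = 1F
toFin (bit true)  = 2F
toFin (other i)   = suc (suc (suc i))

fromFin-toFin : ∀ {k} (s : Symbol k) → fromFin (toFin s) ≡ s
fromFin-toFin blank       = refl
fromFin-toFin (bit false) = refl
fromFin-toFin (bit true)  = refl
fromFin-toFin (other i)   = refl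

symbol : ∀ k → Decoder (Symbol k)
symbol k = finite (2 + k) >>= λ i → return (fromFin i)

symbol-complete : ∀ k → Complete (symbol k)
symbol-complete k s =
  yields->>= (finite-complete (2 + k) (toFin s)) λ { refl → yields-return (fromFin-toFin s) }

vector : ∀ {A} n → Decoder A → Decoder (Vec A n)
vector zero    d = return []
vector (suc n) d = d >>= λ a → vector n d >>= λ as → return (a ∷ as)

vector-complete : ∀ {A} {d : Decoder A} → Complete d → ∀ {n} → Complete (vector n d)
vector-complete d-complete []       = yields-return refl
vector-complete d-complete (a ∷ as) =
  yields->>= (d-complete a) λ { refl →
  yields->>= (vector-complete d-complete as) λ { refl → yields-return refl } }

onFin : ∀ {A} n → Decoder A → Decoder (Fin n → A)
onFin zero    d = return λ ()
onFin (suc n) d = d >>= λ a → onFin n d >>= λ f → return λ { zero → a ; (suc i) → f i }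

-- A function is coded by the table of its values. The decoded function is described pointwise,
-- since equality with a given function would call for extensionality.
onFin-complete : ∀ {A n} {d : Decoder A} {P : Fin n → A → Set} →
  (∀ i → Yields d (P i)) → Yields (onFin n d) λ f → ∀ i → P i (f i)
onFin-complete {n = zero}  d-complete = yields-return λ ()
onFin-complete {n = suc n} d-complete =
  yields->>= (d-complete zero) λ p →
  yields->>= (onFin-complete (d-complete ∘ suc)) λ ps →
  yields-return λ { zero → p ; (suc i) → ps i }

onSymbols : ∀ {A} k n → Decoder A → Decoder (Vec (Symbol k) n → A)
onSymbols k zero    d = d >>= λ a → return λ _ → a
onSymbols k (suc n) d =
  onFin (3 + k) (onSymbols k n d) >>= λ f → return λ { (s ∷ v) → f (toFin s) v }

onSymbols-complete : ∀ {A k n} {d : Decoder A} {P : Vec (Symbol k) n → A → Set} →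
  (∀ v → Yields d (P v)) → Yields (onSymbols k n d) λ f → ∀ v → P v (f v)
onSymbols-complete {n = zero}  d-complete =
  yields->>= (d-complete []) λ p → yields-return λ { [] → p }
onSymbols-complete {n = suc n} {P = P} d-complete =
  yields->>= (onFin-complete λ i → onSymbols-complete {P = λ v → P (fromFin i ∷ v)} λ v →
              d-complete (fromFin i ∷ v)) λ {f} p →
  yields-return λ { (s ∷ v) →
    -- The table is indexed by numbers, so its entry for `s` is known to be right for
    -- `fromFin (toFin s)`.
    subst (λ s′ → P (s′ ∷ v) (f (toFin s) v)) (fromFin-toFin s) (p (toFin s) v) }

writing : ∀ k → Decoder (Symbol k × Direction)
writing k = symbol k >>= λ s → direction >>= λ d → return (s , d)

writing-complete : ∀ k → Complete (writing k)
writing-complete k (s , d) =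
  yields->>= (symbol-complete k s) λ { refl →
  yields->>= (direction-complete d) λ { refl → yields-return refl } }

halting querying working action : ∀ k e n → Decoder (Action k e (suc n))
halting  k e n = boolean >>= λ a → return (halt a)
querying k e n = finite n >>= λ s₁ → finite n >>= λ s₂ → return (query s₁ s₂)
working  k e n =
  finite n >>= λ s → vector e (writing k) >>= λ ws →
  optionalBit >>= λ b → optionalBit >>= λ c → return (work s ws b c)
action k e n = oneOf halting (querying ∷ working ∷ []) >>= λ d → d k e n

action-complete : ∀ k e n → Complete (action k e n)
action-complete k e n (halt a) =
  yields->>= (oneOf-complete (here refl)) λ { refl →
  yields->>= (boolean-complete a) λ { refl → yields-return refl } }
action-complete k e n (query s₁ s₂) =
  yields->>= (oneOf-complete (there (here refl))) λ { refl →
  yields->>= (finite-complete n s₁) λ { refl →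
  yields->>= (finite-complete n s₂) λ { refl → yields-return refl } } }
action-complete k e n (work s ws b c) =
  yields->>= (oneOf-complete (there (there (here refl)))) λ { refl →
  yields->>= (finite-complete n s) λ { refl →
  yields->>= (vector-complete (writing-complete k) ws) λ { refl →
  yields->>= (optionalBit-complete b) λ { refl →
  yields->>= (optionalBit-complete c) λ { refl → yields-return refl } } } } }

oracleTM : Decoder OracleTM
oracleTM =
  natural >>= λ k → natural >>= λ e → natural >>= λ n → finite n >>= λ i →
  onFin (suc n) (onSymbols k (suc e) (action k (suc e) n)) >>= λ δ →
  return (record { aux = k ; extra = e ; states = suc n ; start = i ; program = δ })

oracleTM-complete : ∀ M → Yields oracleTM (_≈ M)
-- The start state rules out a machine with zero states.
oracleTM-complete record { aux = k ; extra = e ; states = suc n ; start = i ; program = δ } =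
  yields->>= (natural-complete k) λ { refl →
  yields->>= (natural-complete e) λ { refl →
  yields->>= (natural-complete n) λ { refl →
  yields->>= (finite-complete n i) λ { refl →
  yields->>= (onFin-complete λ s → onSymbols-complete λ v →
              action-complete k (suc e) n (δ s v)) λ eq →
  yields-return (same eq) } } } }

polynomial : Decoder Polynomial
polynomial = natural >>= λ n → vector n natural >>= λ as → return (Vec.toList as)

polynomial-complete : Complete polynomial
polynomial-complete p =
  yields->>= (natural-complete (length p)) λ { refl →
  yields->>= (vector-complete natural-complete (Vec.fromList p)) λ { refl →
  yields-return (toList∘fromList p) } }

clockedTM : Decoder (OracleTM × Polynomial)
clockedTM = oracleTM >>= λ M → polynomial >>= λ p → return (M , p)

clockedTM-complete : ∀ M p → Yields clockedTM λ (M′ , p′) → M′ ≈ M × p′ ≡ p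
clockedTM-complete M p =
  yields->>= (oracleTM-complete M) λ M′≈M →
  yields->>= (polynomial-complete p) λ p′≡p → yields-return (M′≈M , p′≡p)

-- These numerals are bijective base 2: every word over the two digits is a numeral, without trouble
-- from leading zeros.
toWord : ℕᵇ → Word
toWord 0ᵇ       = []
toWord 2[1+ b ] = true ∷ toWord b
toWord 1+[2 b ] = false ∷ toWord b

fromWord : Word → ℕᵇ
fromWord []          = 0ᵇ
fromWord (true ∷ w)  = 2[1+ fromWord w ]
fromWord (false ∷ w) = 1+[2 fromWord w ]

toWord-fromWord : ∀ w → toWord (fromWord w) ≡ w
toWord-fromWord []          = refl
toWord-fromWord (true ∷ w)  = cong (true ∷_) (toWord-fromWord w)
toWord-fromWord (false ∷ w) = cong (false ∷_) (toWord-fromWord w)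

opaque
  nthTM : ℕ → OracleTM × Polynomial
  nthTM i = proj₁ (clockedTM (toWord (fromℕ i)))

  -- The index is the number whose numeral is a code of the pair; the code is decoded with nothing
  -- following it.
  nthTM-complete : ∀ M p → ∃[ i ] proj₁ (nthTM i) ≈ M × proj₂ (nthTM i) ≡ p
  nthTM-complete M p =
    toℕ (fromWord code) , subst (λ c → proj₁ c ≈ M × proj₂ c ≡ p) (sym nth≡value) satisfies
    where
    open Yields (clockedTM-complete M p)
    nth≡value : nthTM (toℕ (fromWord code)) ≡ value
    nth≡value = cong proj₁
      (trans (cong (clockedTM ∘ toWord) (fromℕ-toℕ (fromWord code)))
      (trans (cong clockedTM (trans (toWord-fromWord code) (sym (++-identityʳ code))))
             (decodes [])))

-- Diagonalisation

-- As long as the answers agree, both runs pass through the same configurations and so ask the same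
-- next word. Hence agreement on the queries of the first run is enough.
run-agree : ∀ M {X Y} t c {r} → run M X t c ≡ just r →
            All (λ q → X q ≡ Y q) (queries r) → run M Y t c ≡ just r
perform-agree : ∀ M {X Y} t c a {r} → perform M X t c a ≡ just r →
                All (λ q → X q ≡ Y q) (queries r) → perform M Y t c a ≡ just r
run-agree M (suc t) c =
  perform-agree M t c (OracleTM.program M (Config.state c) (Vec.map scanned (Config.tapes c)))
perform-agree M t (config s ts q o) (halt _) eq agree = eq
perform-agree M {X} {Y} t (config s ts q o) (query s₁ s₂) eq agree
  with run M X t (config (branch M (X q) s₁ s₂) ts [] o) in eq′
perform-agree M {X} {Y} t (config s ts q o) (query s₁ s₂) refl (Xq≡Yq ∷ agree)
  | just r rewrite sym Xq≡Yq = cong (Maybe.map (addQuery q)) (run-agree M t _ eq′ agree)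
perform-agree M t (config s ts q o) (work s′ ws b c) = run-agree M t _

-- One step of the diagonalisation

probe : Bool → ℕ → Word
probe b n = b ∷ replicate n true

-- Two different words of the first length above `n`, where a stage of height `n` is still empty.
probes : ℕ → List Word
probes n = probe false n ∷ probe true n ∷ []

length-probe : ∀ {n z} → z ∈ probes n → length z ≡ suc n
length-probe {n} (here refl)         = cong suc (length-replicate n)
length-probe {n} (there (here refl)) = cong suc (length-replicate n)

record Stage : Set where
  constructor stage
  field
    height  : ℕ
    members : Language

open Stage

EmptyAbove : Stage → Set
EmptyAbove (stage n X) = ∀ w → n < length w → X w ≡ false

data Addition (n : ℕ) (r : Outcome) : Maybe Word → Set where
  add  : ∀ {z} → accepted r ≡ false → z ∈ probes n → z ∉ queries r → Addition n r (just z)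
  keep : accepted r ≡ true ⊎ All (_∈ queries r) (probes n) → Addition n r nothing

_≟_ : (u v : Word) → Dec (u ≡ v)
_≟_ = ≡-dec _≟ᵇ_

_∈?_ : (u : Word) (ws : List Word) → Dec (u ∈ ws)
_∈?_ = member? _≟_

addition : ∀ n r → ∃ (Addition n r)
addition n r with accepted r in eq
... | true  = nothing , keep (inj₁ eq)
... | false with probe false n ∈? queries r | probe true n ∈? queries r
...   | no  p∉ | _      = _ , add eq (here refl) p∉
...   | yes _  | no q∉  = _ , add eq (there (here refl)) q∉
...   | yes p∈ | yes q∈ = nothing , keep (inj₂ (p∈ ∷ q∈ ∷ []))

insert : Maybe Word → Language → Language
insert nothing  X   = X
insert (just z) X w = does (w ≟ z) ∨ X w

update : Outcome → Stage → Stage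
update r (stage n X) =
  -- The sum bounds the length of each query, and `suc n` is the length of the probes, so the new
  -- height covers both.
  stage (suc (n + sum (map length (queries r)))) (insert (proj₁ (addition n r)) X)

insert-self : ∀ z X → insert (just z) X z ≡ true
insert-self z X rewrite dec-true (z ≟ z) refl = refl

insert-other : ∀ {z w} X → w ≢ z → insert (just z) X w ≡ X w
insert-other {z} {w} X w≢z rewrite dec-false (w ≟ z) w≢z = refl

update-other : ∀ r n X w → length w ≢ suc n → members (update r (stage n X)) w ≡ X w
update-other r n X w ≢1+n with addition n r
... | nothing , _         = refl
... | just z , add _ z∈ _ = insert-other X λ { refl → ≢1+n (length-probe z∈) }

-- A word is inserted only if it was not asked; thus the simulated computation stays valid for the
-- new set.
update-query : ∀ r n X {w} → w ∈ queries r → members (update r (stage n X)) w ≡ X w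
update-query r n X w∈ with addition n r
... | nothing , _         = refl
... | just z , add _ _ z∉ = insert-other X λ { refl → z∉ w∈ }

update-emptyAbove : ∀ r s → EmptyAbove s → EmptyAbove (update r s)
update-emptyAbove r (stage n X) empty w h<w =
  trans (update-other r n X w λ eq → <⇒≢ (≤-<-trans (s≤s (m≤m+n n _)) h<w) (sym eq))
        (empty w (<-trans (s≤s (m≤m+n n _)) h<w))

length≤sum : ∀ {w : Word} ws → w ∈ ws → length w ≤ sum (map length ws)
length≤sum (w ∷ ws) (here refl) = m≤m+n (length w) _
length≤sum (v ∷ ws) (there w∈)  = ≤-trans (length≤sum ws w∈) (m≤n+m _ (length v))

-- The common consequence of increasing and of decreasing query lengths, so that one diagonalisation
-- serves both reductions.
DistinctLengths : List Word → Set
DistinctLengths = AllPairs (_≢_ on length)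

distinctLengths-injective : ∀ {ws u v} → DistinctLengths ws → u ∈ ws → v ∈ ws →
                            length u ≡ length v → u ≡ v
distinctLengths-injective (_  ∷ _)  (here refl) (here refl) eq = refl
distinctLengths-injective (ds ∷ _)  (here refl) (there v∈)  eq = contradiction eq (All.lookup ds v∈)
distinctLengths-injective (ds ∷ _)  (there u∈)  (here refl) eq = contradiction (sym eq) (All.lookup ds u∈)
distinctLengths-injective (_  ∷ ps) (there u∈)  (there v∈)  eq = distinctLengths-injective ps u∈ v∈ eq

-- A rejection is refuted by the inserted probe, an acceptance by the absence of both probes. If
-- both probes were asked, the lengths are not distinct.
update-defeats : ∀ r n X (A : Language) → EmptyAbove (stage n X) →
  (∀ w → length w ≤ height (update r (stage n X)) → A w ≡ members (update r (stage n X)) w) →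
  DistinctLengths (queries r) → A (probe false n) ∨ A (probe true n) ≢ accepted r
update-defeats r n X A empty settled distinct eq with addition n r
... | just z , add rejects z∈ _ =
  contradiction (trans (sym (disjunction z∈ Az)) (trans eq rejects)) λ ()
  where
  Az : A z ≡ true
  Az = trans (settled z (≤-trans (≤-reflexive (length-probe z∈)) (s≤s (m≤m+n n _))))
             (insert-self z X)
  disjunction : ∀ {z} → z ∈ probes n → A z ≡ true → A (probe false n) ∨ A (probe true n) ≡ true
  disjunction (here refl)         Az rewrite Az = refl
  disjunction (there (here refl)) Az rewrite Az = ∨-zeroʳ _
... | nothing , keep (inj₁ accepts) =
  contradiction (trans (sym (cong₂ _∨_ (absent (here refl)) (absent (there (here refl)))))
                       (trans eq accepts)) λ ()
  where
  absent : ∀ {z} → z ∈ probes n → A z ≡ false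
  absent z∈ = trans (settled _ (≤-trans (≤-reflexive (length-probe z∈)) (s≤s (m≤m+n n _))))
                    (empty _ (≤-reflexive (sym (length-probe z∈))))
... | nothing , keep (inj₂ (p∈ ∷ q∈ ∷ [])) =
  -- The probes have equal length but differ in their first letter.
  contradiction (distinctLengths-injective distinct p∈ q∈ refl) λ ()

-- The stages and their limit

diagonalInput : ℕ → Word
diagonalInput n = ⟨ probes n ⟩

orLanguage-diagonalInput : ∀ A n →
  orLanguage A (diagonalInput n) ≡ A (probe false n) ∨ A (probe true n)
orLanguage-diagonalInput A n =
  cong₂ (λ u v → A u ∨ A v)
    (first-encodeThen p _)
    (trans (cong first (rest-encodeThen p _)) (first-encodeThen q _))
  where
  p q : Word
  p = probe false n
  q = probe true n

-- An enumerated machine may exceed its clock. Such a run counts as accepting without queries, so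
-- nothing is inserted for it.
diagonalOutcome : OracleTM × Polynomial → Stage → Outcome
diagonalOutcome (M , p) (stage n X) =
  Maybe.fromMaybe (outcome true [] [])
    (run M X (eval p (length (diagonalInput n))) (initial M (diagonalInput n)))

stages : ℕ → Stage
stages zero    = stage 0 ∅
stages (suc i) = update (diagonalOutcome (nthTM i) (stages i)) (stages i)

-- Stage i is final on the words of length at most its height, which is at
-- least i.
diagonal : Language
diagonal w = members (stages (length w)) w

stages-emptyAbove : ∀ i → EmptyAbove (stages i)
stages-emptyAbove zero    w _ = refl
stages-emptyAbove (suc i) =
  update-emptyAbove (diagonalOutcome (nthTM i) (stages i)) (stages i) (stages-emptyAbove i)

height-mono : ∀ k i → k + height (stages i) ≤ height (stages (k + i))
height-mono zero    i = ≤-refl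
height-mono (suc k) i = s≤s (≤-trans (height-mono k i) (m≤m+n _ _))

stages-stable : ∀ k i w → length w ≤ height (stages i) →
                members (stages (k + i)) w ≡ members (stages i) w
stages-stable zero    i w w≤ = refl
stages-stable (suc k) i w w≤ =
  trans (update-other (diagonalOutcome (nthTM (k + i)) s) (height s) (members s) w
           -- A later stage inserts only words longer than its height, which is at least that of
           -- stage `i`.
           (<⇒≢ (s≤s (≤-trans w≤ (≤-trans (m≤n+m _ k) (height-mono k i))))))
        (stages-stable k i w w≤)
  where s = stages (k + i)

index≤height : ∀ i → i ≤ height (stages i)
index≤height zero    = z≤n
index≤height (suc i) = s≤s (≤-trans (index≤height i) (m≤m+n _ _))

-- The earlier of the stages `i` and `length w` already covers `w`, by the hypothesis or by
-- `index≤height`, and the later one agrees with it.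
diagonal-settled : ∀ i w → length w ≤ height (stages i) → diagonal w ≡ members (stages i) w
diagonal-settled i w w≤ with ≤-total i (length w)
... | inj₁ i≤ = subst (λ j → members (stages j) w ≡ members (stages i) w)
                      (m∸n+n≡m i≤) (stages-stable (length w ∸ i) i w w≤)
... | inj₂ ≤i = sym (subst (λ j → members (stages j) w ≡ diagonal w)
                      (m∸n+n≡m ≤i) (stages-stable (i ∸ length w) (length w) w (index≤height _)))

-- At the stage whose index names `D`, the simulated outcome is also the outcome with the final
-- oracle, and that stage has defeated it.
orDiagonal-undecided : ∀ D → (∀ x → DistinctLengths (queries (result D diagonal x))) →
                       ¬ (L D diagonal ≗ orLanguage diagonal)
orDiagonal-undecided D distinct L≗
  with i , M′≈M , p′≡p ← nthTM-complete (machine D) (DPTM.bound D) =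
  update-defeats r n X diagonal (stages-emptyAbove i) settled
    (subst (DistinctLengths ∘ queries) result≡r (distinct x))
    (trans (sym (orLanguage-diagonalInput diagonal n))
           (trans (sym (L≗ x)) (cong accepted result≡r)))
  where
  M = machine D
  p = DPTM.bound D
  n = height (stages i)
  X = members (stages i)
  x = diagonalInput n
  t = eval p (length x)
  r = result D X x

  stage≡ : stages (suc i) ≡ update r (stages i)
  -- The enumerated copy runs like `D`, and `D` halts within its bound, so the default outcome is
  -- not taken.
  stage≡ = cong (λ m → update (Maybe.fromMaybe (outcome true [] []) m) (stages i))
    (trans (run-initial-≈ M′≈M X (eval (proj₂ (nthTM i)) (length x)) x)
    (trans (cong (λ p → run M X (eval p (length x)) (initial M x)) p′≡p)
           (proj₂ (DPTM.halts D X x))))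

  settled : ∀ w → length w ≤ height (update r (stages i)) →
            diagonal w ≡ members (update r (stages i)) w
  settled = subst (λ s → ∀ w → length w ≤ height s → diagonal w ≡ members s w)
                  stage≡ (diagonal-settled (suc i))

  agree : All (λ q → X q ≡ diagonal q) (queries r)
  -- Each query lies below the new height, where `diagonal` is settled, and was not inserted at this
  -- stage.
  agree = All.tabulate λ {q} q∈ → sym
    (trans (settled q (m≤n⇒m≤1+n (≤-trans (length≤sum (queries r) q∈) (m≤n+m _ n))))
           (update-query r n X q∈))

  result≡r : result D diagonal x ≡ r
  result≡r = just-injective
    (trans (sym (proj₂ (DPTM.halts D diagonal x)))
           (run-agree M t (initial M x) (proj₂ (DPTM.halts D X x)) agree))

theorem4p4 : ∃₂ λ (A B : Language) → (B ≤ᵖ2-tt A) × (¬ (B ≤ᵖli-T A)) × (¬ (B ≤ᵖld-T A))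
theorem4p4 = diagonal , orLanguage diagonal , orLanguage-≤ᵖ2-tt diagonal ,
  -- Transitivity carries the strict order from neighbouring queries to all pairs, whose lengths
  -- therefore differ.
  (λ { (D , L≗ , increasing) → orDiagonal-undecided D
         (λ x → AllPairs.map <⇒≢ (Linked⇒AllPairs <-trans (increasing x))) L≗ }) ,
  (λ { (D , L≗ , decreasing) → orDiagonal-undecided D
         (λ x → AllPairs.map >⇒≢ (Linked⇒AllPairs (λ {u v w} u>v v>w → <-trans {length w} v>w u>v)
                                                 (decreasing x))) L≗ })
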